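{- Let $G=(V,E)$ be a connected digraph, and let $u$ be a vertex in $G$. If $u$ does not have an edge to a vertex $v\neq u$ (that is, $uv\notin E$), then there is an out-neighbor $x$ of $u$ such that $\mathbb{P}(L(x,v)) \le \mathbb{P}(L(u,v))$. Furthermore, this inequality is strict (for some such out-neighbor $x$) if there is a directed walk from $u$ to $v$ which visits all vertices in $G$, but does not revisit $u$.
   Context: Digraphs are finite and simple: there are no loops and at most one edge from $a$ to $b$ for each ordered pair of distinct vertices $(a,b)$; both $ab$ and $ba$ may be edges, where $ab$ denotes the edge directed from $a$ to $b$. Connected means strongly connected (there is a directed walk from every vertex to every other vertex). An out-neighbor of $u$ is a vertex $x$ with $ux\in E$. A cover tour of $G$ from a vertex $u$ is a directed walk which begins at $u$ and ends when it has visited every vertex of $G$. A random cover tour from $u$ is the random walk that starts at $u$ (which counts as visited), moves at each step with equal probability to any out-neighbor of its current vertex, and ends when it has visited every vertex. $L(u,v)$ denotes the event that $v$ is the last vertex to be visited by a random cover tour beginning at $u$. A walk starting at $u$ does not revisit $u$ if $u$ occurs in it only as its first vertex.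
   Formalization: In the strictness clause the walk from u to v must reach v only at its end. Otherwise it fails: for edges ua, av, vb, bv, bu the walk u,a,v,b,v visits all vertices without revisiting u, yet P(L(u,v)) = P(L(a,v)) = 0. -}

module Defs where

open import Data.Fin.Base using (Fin)
open import Data.Fin.Properties using (_≟_; all?)
open import Data.Integer.Base using (+_)
open import Data.List.Base as List using (List)
open import Data.Nat.Base using (ℕ; zero; suc)
open import Data.Product.Base using (∃; ∃-syntax; _×_)
open import Data.Rational.Base using (ℚ; 0ℚ; 1ℚ; _+_; _*_; _/_; _<_)
open import Data.Vec.Base as Vec using (Vec; []; _∷_; head; tail; init; last)
open import Data.Vec.Relation.Unary.Linked using (Linked; linked?)
open import Level using (0ℓ)
open import Relation.Binary.Construct.Closure.ReflexiveTransitive using (Star)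
open import Relation.Binary.Core using (Rel)
open import Relation.Binary.Definitions using (Decidable)
open import Relation.Binary.PropositionalEquality using (_≡_)
open import Relation.Nullary using (¬_)
open import Relation.Nullary.Decidable using (Dec; _×-dec_; ¬?)
open import Relation.Unary as Unary using (Pred; _⊆_)
import Data.Vec.Membership.DecPropositional as DecMembership

-- A real number is given by its lower Dedekind cut, the set of rationals
-- strictly below it.

Cut : Set₁
Cut = Pred ℚ 0ℓ

infix 4 _≤ᶜ_ _<ᶜ_

_≤ᶜ_ : Cut → Cut → Set
A ≤ᶜ B = A ⊆ B

_<ᶜ_ : Cut → Cut → Set
A <ᶜ B = ∃[ q ] ¬ A q × B q

sumℚ : List ℚ → ℚ
sumℚ = List.foldr _+_ 0ℚ

partialSum : (ℕ → ℚ) → ℕ → ℚ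
partialSum a zero    = 0ℚ
partialSum a (suc m) = partialSum a m + a m

-- For non-negative terms the partial sums increase, so this is the cut of
-- the sum of the infinite series.

series : (ℕ → ℚ) → Cut
series a q = ∃[ m ] q < partialSum a m

-- The value at 0 is never used by a walk: every vertex of a walk but the
-- last has an out-neighbour.

recip : ℕ → ℚ
recip zero    = 0ℚ
recip (suc d) = + 1 / suc d

record Digraph (n : ℕ) : Set₁ where
  infix 4 _⟶_ _⟶?_
  field
    _⟶_      : Rel (Fin n) 0ℓ
    _⟶?_     : Decidable _⟶_
    loopless : ∀ {a} → ¬ (a ⟶ a)

module _ {n : ℕ} (G : Digraph n) where
  open Digraph G
  open DecMembership (_≟_ {n}) using (_∈_; _∉_; _∈?_)

  Connected : Set
  Connected = ∀ a b → Star _⟶_ a b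

  outdegree : Fin n → ℕ
  outdegree a = Vec.count (a ⟶?_) (Vec.allFin n)

  -- A walk with k steps is the vector of the 1 + k vertices it goes through.

  IsWalk : ∀ {k} → Pred (Vec (Fin n) (suc k)) 0ℓ
  IsWalk w = Linked _⟶_ w

  VisitsAll : ∀ {k} → Pred (Vec (Fin n) k) 0ℓ
  VisitsAll w = ∀ x → x ∈ w

  visitsAll? : ∀ {k} → Unary.Decidable (VisitsAll {k})
  visitsAll? w = all? (_∈? w)

  -- A walk that stops as soon as every vertex has been visited.

  IsCoverTour : ∀ {k} → Pred (Vec (Fin n) (suc k)) 0ℓ
  IsCoverTour w = IsWalk w × VisitsAll w × ¬ VisitsAll (init w)

  -- The event L(u,v), as a set of cover tours.

  L : ∀ {k} → Fin n → Fin n → Pred (Vec (Fin n) (suc k)) 0ℓ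
  L u v w = IsCoverTour w × head w ≡ u × last w ≡ v

  L? : ∀ {k} u v → Unary.Decidable (L {k} u v)
  L? u v w = (linked? _⟶?_ w ×-dec visitsAll? w ×-dec ¬? (visitsAll? (init w)))
             ×-dec head w ≟ u ×-dec last w ≟ v

  -- The probability that the random walk from head w begins with w: a factor
  -- 1 / outdegree for each vertex that is left by a step.

  weight : ∀ {k} → Vec (Fin n) (suc k) → ℚ
  weight w = Vec.foldr′ _*_ 1ℚ (Vec.map (λ a → recip (outdegree a)) (init w))

  sequences : ∀ k → List (Vec (Fin n) k)
  sequences zero    = List.[ [] ]
  sequences (suc k) = List.cartesianProductWith _∷_ (List.allFin n) (sequences k)

  -- The probability that the random cover tour from u has exactly k steps and
  -- ends at v.

  ℙL[_,_]at : Fin n → Fin n → ℕ → ℚ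
  ℙL[ u , v ]at k = sumℚ (List.map weight (List.filter (L? u v) (sequences (suc k))))

  ℙL : Fin n → Fin n → Cut
  ℙL u v = series ℙL[ u , v ]at

  -- A walk from u to v is understood to end on reaching v, hence v ∉ init w.
  -- If v could be passed earlier, the strict inequality would fail: for the
  -- edges u→a, a→v, v→b, b→v, b→u, the walk u a v b v visits every vertex and
  -- does not revisit u, but v is never the last vertex visited by a cover tour
  -- from u or from a.

  HasCoveringWalkNotRevisitingStart : Fin n → Fin n → Set
  HasCoveringWalkNotRevisitingStart u v =
    ∃[ k ] ∃ λ (w : Vec (Fin n) (suc k)) →
      IsWalk w × head w ≡ u × last w ≡ v × v ∉ init w ×
      VisitsAll w × u ∉ tail w

{-# OPTIONS --safe #-}
module Submission where

-- Since v is not u, the first step of a tour from u gives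
-- P(L(u,v)) ≥ Σ_x p(u,x) P′(x), where P′(x) is the probability that the walk
-- from x reaches v only after visiting every vertex other than u. As
-- P′(x) ≥ P(L(x,v)), the out-neighbour x minimising P(L(x,v)) satisfies the
-- inequality; a covering walk that does not revisit u gives
-- P′(y) > P(L(y,v)) for its second vertex y, which makes it strict.
--
-- To choose x constructively the probabilities must be comparable, so they
-- are shown to be rational: they solve the linear system h = β + T h of the
-- walk killed at v, remembering the set of visited vertices, and the partial
-- sums of the series converge to h because the expected lifetime is finite.

open import Defs
open import Algebra.Bundles using (CommutativeRing)
open import Data.Bool.Base using (true; false; if_then_else_)
open import Data.Fin.Base using (Fin; zero; suc)
open import Data.Fin.Properties using (_≟_; all?)
open import Data.Fin.Subset using (Subset; inside; outside; _∈_; _∉_; _⊆_; _∪_; ⁅_⁆; ∣_∣; ⊥)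
open import Data.Fin.Subset.Properties
  using (_∈?_; p⊆p∪q; q⊆p∪q; x∈p∪q⁻; x∈p∪q⁺; x∈⁅x⁆; x∈⁅y⁆⇒x≡y; ⊆-antisym;
         ∣p∣≤∣p∪q∣; p⊂q⇒∣p∣<∣q∣; ∣p∣≤n; ∉⊥; ⊥⊆)
open import Data.Integer.Base as ℤ using (+[1+_]; -[1+_]) renaming (+_ to int)
import Data.Integer.Properties as ℤ
open import Data.List.Base as List using (List; []; _∷_; _++_)
open import Data.List.Membership.Propositional.Properties using (∈-filter⁺; ∈-allFin)
open import Data.List.Properties using (map-∘)
import Data.List.Relation.Unary.All as All
open import Data.List.Relation.Unary.All.Properties using (all-filter)
open import Data.Nat.Base as ℕ using (ℕ; zero; suc)
open import Data.Nat.Coprimality using (1-coprimeTo) renaming (sym to coprime-sym)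
import Data.Nat.Properties as ℕ
open import Data.Product.Base using (∃; ∃-syntax; _×_; _,_; proj₁; proj₂)
open import Data.Rational.Base hiding (∣_∣)
open import Data.Rational.Properties hiding (_≟_)
import Data.Rational.Unnormalised.Base as ℚᵘ
import Data.Rational.Unnormalised.Properties as ℚᵘ
open import Data.Sum.Base using (_⊎_; inj₁; inj₂; [_,_]′) renaming (map to ⊎-map)
open import Data.Vec.Base as Vec using (Vec; []; _∷_; init; last)
import Data.Vec.Membership.Propositional as Vec
open import Data.Vec.Relation.Unary.Any using (here; there)
open import Data.Vec.Relation.Unary.Linked using ([-]; _∷_)
open import Function.Base using (_∘_; id; case_of_)
open import Level using (0ℓ)
open import Relation.Binary.Bundles using (DecTotalOrder)
open import Relation.Binary.Construct.Closure.ReflexiveTransitive using (Star; ε; _◅_)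
open import Relation.Binary.PropositionalEquality
  using (_≡_; _≢_; refl; sym; trans; cong; cong₂; subst; module ≡-Reasoning)
open import Relation.Nullary using (¬_; Dec; yes; no; does; contradiction)
open import Relation.Nullary.Decidable using (dec-true; dec-false; _×-dec_)
open import Relation.Unary using (Pred; Decidable)
open import Data.List.Extrema (DecTotalOrder.totalOrder ≤-decTotalOrder)
  using (argmin; f[argmin]≤f[xs]; argmin-all)
open import Algebra.Properties.Semiring.Sum (CommutativeRing.semiring +-*-commutativeRing)
  using (sum; sum-cong-≗; ∑-distrib-+; *-distribˡ-sum)
open import Algebra.Solver.Ring.NaturalCoefficients.Default
  (CommutativeRing.commutativeSemiring +-*-commutativeRing)
  using (solve; _:=_; _:+_; _:*_)

0≤p+q : ∀ {p q} → 0ℚ ≤ p → 0ℚ ≤ q → 0ℚ ≤ p + q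
0≤p+q = +-mono-≤

*-monoˡ-≤ : ∀ {r p q} → 0ℚ ≤ r → p ≤ q → r * p ≤ r * q
*-monoˡ-≤ {r} 0≤r = *-monoˡ-≤-nonNeg r {{nonNegative 0≤r}}

*-monoʳ-< : ∀ {r p q} → 0ℚ < r → p < q → r * p < r * q
*-monoʳ-< {r} 0<r = *-monoʳ-<-pos r {{positive 0<r}}

0≤p*q : ∀ {p q} → 0ℚ ≤ p → 0ℚ ≤ q → 0ℚ ≤ p * q
0≤p*q {p} {q} 0≤p 0≤q = subst (_≤ p * q) (*-zeroʳ p) (*-monoˡ-≤ 0≤p 0≤q)

p≤p+q : ∀ {p q} → 0ℚ ≤ q → p ≤ p + q
p≤p+q {p} {q} 0≤q = subst (_≤ p + q) (+-identityʳ p) (+-monoʳ-≤ p 0≤q)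

p≤q+p : ∀ {p q} → 0ℚ ≤ q → p ≤ q + p
p≤q+p {p} {q} 0≤q = subst (p ≤_) (+-comm p q) (p≤p+q 0≤q)

+-cancelˡ-≤ : ∀ r {p q} → r + p ≤ r + q → p ≤ q
+-cancelˡ-≤ r {p} {q} le = ≮⇒≥ λ q<p → <-irrefl refl (<-≤-trans (+-monoʳ-< r q<p) le)

p<q⇒0<q-p : ∀ {p q} → p < q → 0ℚ < q - p
p<q⇒0<q-p {p} {q} p<q = subst (_< q - p) (+-inverseʳ p) (+-monoˡ-< (- p) p<q)

abstract
  inverse : ∀ {p} → 0ℚ < p → ∃[ q ] 0ℚ < q × p * q ≡ 1ℚ
  inverse {p} 0<p = 1/ p , positive⁻¹ (1/ p) {{1/pos⇒pos p}} , *-inverseʳ p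
    where instance
      p-pos : Positive p
      p-pos = positive 0<p
      p≢0 : NonZero p
      p≢0 = pos⇒nonZero p

sum-nonNeg : ∀ {n} {f : Fin n → ℚ} → (∀ i → 0ℚ ≤ f i) → 0ℚ ≤ sum f
sum-nonNeg {zero}  0≤f = ≤-refl
sum-nonNeg {suc n} 0≤f = 0≤p+q (0≤f zero) (sum-nonNeg (0≤f ∘ suc))

sum-mono-≤ : ∀ {n} {f g : Fin n → ℚ} → (∀ i → f i ≤ g i) → sum f ≤ sum g
sum-mono-≤ {zero}  f≤g = ≤-refl
sum-mono-≤ {suc n} f≤g = +-mono-≤ (f≤g zero) (sum-mono-≤ (f≤g ∘ suc))

sum-mono-< : ∀ {n} {f g : Fin n → ℚ} → (∀ i → f i ≤ g i) → ∀ i → f i < g i → sum f < sum g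
sum-mono-< f≤g zero    lt = +-mono-<-≤ lt (sum-mono-≤ (f≤g ∘ suc))
sum-mono-< f≤g (suc i) lt = +-mono-≤-< (f≤g zero) (sum-mono-< (f≤g ∘ suc) i lt)

-- Gaussian elimination: eliminating the first unknown preserves the
-- hypotheses on the matrix, with the same test vector g.

solve-nonNeg : ∀ m (Q : Fin m → Fin m → ℚ) (r g : Fin m → ℚ) →
  (∀ i j → 0ℚ ≤ Q i j) → (∀ i → 0ℚ ≤ r i) → (∀ i → 0ℚ ≤ g i) →
  (∀ i → sum (λ j → Q i j * g j) < g i) →
  ∃ λ (f : Fin m → ℚ) → (∀ i → 0ℚ ≤ f i) × (∀ i → f i ≡ r i + sum (λ j → Q i j * f j))
solve-nonNeg zero    Q r g 0≤Q 0≤r 0≤g Qg<g = (λ ()) , (λ ()) , λ ()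
solve-nonNeg (suc m) Q r g 0≤Q 0≤r 0≤g Qg<g = f , 0≤f , f-eq
  where
  q₀ = Q zero zero
  row : (Fin (suc m) → ℚ) → Fin (suc m) → ℚ
  row h i = sum (λ j → Q i (suc j) * h (suc j))

  0≤row : ∀ {h} → (∀ j → 0ℚ ≤ h (suc j)) → ∀ i → 0ℚ ≤ row h i
  0≤row 0≤h i = sum-nonNeg λ j → 0≤p*q (0≤Q i (suc j)) (0≤h j)

  q₀<1 : q₀ < 1ℚ
  q₀<1 with q₀ <? 1ℚ
  ... | yes lt = lt
  ... | no  ≮1 = contradiction (Qg<g zero) λ lt → <-irrefl refl (<-≤-trans lt (begin
    g zero                    ≡⟨ *-identityʳ _ ⟨
    g zero * 1ℚ               ≤⟨ *-monoˡ-≤ (0≤g zero) (≮⇒≥ ≮1) ⟩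
    g zero * q₀               ≡⟨ *-comm (g zero) q₀ ⟩
    q₀ * g zero               ≤⟨ p≤p+q (0≤row {g} (0≤g ∘ suc) zero) ⟩
    q₀ * g zero + row g zero  ∎))
    where open ≤-Reasoning

  0<d : 0ℚ < 1ℚ - q₀
  0<d = p<q⇒0<q-p q₀<1

  d = 1ℚ - q₀

  d+q₀≡1 : d + q₀ ≡ 1ℚ
  d+q₀≡1 = trans (+-assoc 1ℚ (- q₀) q₀) (trans (cong (1ℚ +_) (+-inverseˡ q₀)) (+-identityʳ 1ℚ))

  expand : ∀ y → y ≡ d * y + q₀ * y
  expand y = trans (sym (*-identityˡ y)) (trans (cong (_* y) (sym d+q₀≡1)) (*-distribʳ-+ y d q₀))

  κ = proj₁ (inverse 0<d)

  0≤κ : 0ℚ ≤ κ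
  0≤κ = <⇒≤ (proj₁ (proj₂ (inverse 0<d)))

  d*κ≡1 : d * κ ≡ 1ℚ
  d*κ≡1 = proj₂ (proj₂ (inverse 0<d))

  d*κ*y≡y : ∀ y → d * (κ * y) ≡ y
  d*κ*y≡y y = trans (sym (*-assoc d κ y)) (trans (cong (_* y) d*κ≡1) (*-identityˡ y))

  κ-fix : ∀ y → κ * y ≡ y + q₀ * (κ * y)
  κ-fix y = trans (expand (κ * y)) (cong (_+ q₀ * (κ * y)) (d*κ*y≡y y))

  κ-row≤ : κ * row g zero ≤ g zero
  κ-row≤ = *-cancelˡ-≤-pos d {{positive 0<d}} (+-cancelˡ-≤ (q₀ * g zero) (begin
    q₀ * g zero + d * (κ * row g zero)  ≡⟨ cong (q₀ * g zero +_) (d*κ*y≡y (row g zero)) ⟩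
    q₀ * g zero + row g zero            ≤⟨ <⇒≤ (Qg<g zero) ⟩
    g zero                              ≡⟨ expand (g zero) ⟩
    d * g zero + q₀ * g zero            ≡⟨ +-comm (d * g zero) _ ⟩
    q₀ * g zero + d * g zero            ∎))
    where open ≤-Reasoning

  c : Fin m → ℚ
  c i = Q (suc i) zero * κ

  0≤c : ∀ i → 0ℚ ≤ c i
  0≤c i = 0≤p*q (0≤Q (suc i) zero) 0≤κ

  Q′ : Fin m → Fin m → ℚ
  Q′ i j = Q (suc i) (suc j) + c i * Q zero (suc j)

  r′ : Fin m → ℚ
  r′ i = r (suc i) + c i * r zero

  Q′-sum : ∀ (h : Fin (suc m) → ℚ) i → sum (λ j → Q′ i j * h (suc j)) ≡ row h (suc i) + c i * row h zero
  Q′-sum h i = begin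
    sum (λ j → Q′ i j * h (suc j))
      ≡⟨ sum-cong-≗ (λ j → trans (*-distribʳ-+ (h (suc j)) (Q (suc i) (suc j)) (c i * Q zero (suc j)))
           (cong (Q (suc i) (suc j) * h (suc j) +_) (*-assoc (c i) (Q zero (suc j)) (h (suc j))))) ⟩
    sum (λ j → Q (suc i) (suc j) * h (suc j) + c i * (Q zero (suc j) * h (suc j)))
      ≡⟨ ∑-distrib-+ (λ j → Q (suc i) (suc j) * h (suc j)) (λ j → c i * (Q zero (suc j) * h (suc j))) ⟩
    row h (suc i) + sum (λ j → c i * (Q zero (suc j) * h (suc j)))
      ≡⟨ cong (row h (suc i) +_) (*-distribˡ-sum (c i) (λ j → Q zero (suc j) * h (suc j))) ⟨
    row h (suc i) + c i * row h zero ∎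
    where open ≡-Reasoning

  Q′g<g : ∀ i → sum (λ j → Q′ i j * g (suc j)) < g (suc i)
  Q′g<g i = begin-strict
    sum (λ j → Q′ i j * g (suc j))            ≡⟨ Q′-sum g i ⟩
    row g (suc i) + c i * row g zero          ≡⟨ cong (row g (suc i) +_) (*-assoc (Q (suc i) zero) κ (row g zero)) ⟩
    row g (suc i) + Q (suc i) zero * (κ * row g zero) ≤⟨ +-monoʳ-≤ (row g (suc i)) (*-monoˡ-≤ (0≤Q (suc i) zero) κ-row≤) ⟩
    row g (suc i) + Q (suc i) zero * g zero   ≡⟨ +-comm (row g (suc i)) _ ⟩
    Q (suc i) zero * g zero + row g (suc i)   <⟨ Qg<g (suc i) ⟩
    g (suc i)                                 ∎
    where open ≤-Reasoning

  rec = solve-nonNeg m Q′ r′ (g ∘ suc)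
    (λ i j → 0≤p+q (0≤Q (suc i) (suc j)) (0≤p*q (0≤c i) (0≤Q zero (suc j))))
    (λ i → 0≤p+q (0≤r (suc i)) (0≤p*q (0≤c i) (0≤r zero)))
    (0≤g ∘ suc) Q′g<g

  f : Fin (suc m) → ℚ
  f zero    = κ * (r zero + sum (λ j → Q zero (suc j) * proj₁ rec j))
  f (suc i) = proj₁ rec i

  0≤f : ∀ i → 0ℚ ≤ f i
  0≤f zero    = 0≤p*q 0≤κ (0≤p+q (0≤r zero) (0≤row {f} (proj₁ (proj₂ rec)) zero))
  0≤f (suc i) = proj₁ (proj₂ rec) i

  f-eq : ∀ i → f i ≡ r i + sum (λ j → Q i j * f j)
  f-eq zero = trans (κ-fix (r zero + row f zero))
    (solve 3 (λ x y z → x :+ y :+ z := x :+ (z :+ y)) refl (r zero) (row f zero) (q₀ * f zero))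
  f-eq (suc i) = begin
    f (suc i)                                          ≡⟨ proj₂ (proj₂ rec) i ⟩
    r′ i + sum (λ j → Q′ i j * f (suc j))              ≡⟨ cong (r′ i +_) (Q′-sum f i) ⟩
    r (suc i) + c i * r zero + (row f (suc i) + c i * row f zero)
      ≡⟨ solve 6 (λ x q k y s t → x :+ q :* k :* y :+ (s :+ q :* k :* t) := x :+ (q :* (k :* (y :+ t)) :+ s)) refl
           (r (suc i)) (Q (suc i) zero) κ (r zero) (row f (suc i)) (row f zero) ⟩
    r (suc i) + (Q (suc i) zero * f zero + row f (suc i)) ∎
    where open ≡-Reasoning

fromℕ : ℕ → ℚ
fromℕ m = mkℚ (int m) 0 (coprime-sym (1-coprimeTo m))

fromℕ-suc : ∀ m → fromℕ (suc m) ≡ 1ℚ + fromℕ m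
fromℕ-suc m = toℚᵘ-injective (ℚᵘ.≃-trans
  (ℚᵘ.*≡* (cong (λ i → (int 1 ℤ.+ i) ℤ.* int 1) (sym (ℤ.*-identityʳ (int m)))))
  (ℚᵘ.≃-sym (toℚᵘ-homo-+ 1ℚ (fromℕ m))))

fromℕ*recip : ∀ d → fromℕ (suc d) * recip (suc d) ≡ 1ℚ
fromℕ*recip d = toℚᵘ-injective (ℚᵘ.≃-trans (toℚᵘ-homo-* (fromℕ (suc d)) (recip (suc d)))
  (ℚᵘ.≃-trans (ℚᵘ.*-congˡ (toℚᵘ-fromℚᵘ (ℚᵘ.mkℚᵘ (int 1) d)))
    (ℚᵘ.*≡* (trans (ℤ.*-identityʳ _) (trans (ℤ.*-identityʳ (int (suc d)))
      (sym (trans (ℤ.*-identityˡ _) (ℤ.*-identityˡ (int (suc d))))))))))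

0≤recip : ∀ d → 0ℚ ≤ recip d
0≤recip zero    = ≤-refl
0≤recip (suc d) = nonNegative⁻¹ (recip (suc d)) {{normalize-nonNeg 1 (suc d)}}

archimedean : ∀ p → ∃[ m ] p < fromℕ m
archimedean (mkℚ +[1+ k ] d c) = suc (suc k) ,
  *<* (ℤ.+<+ (subst (ℕ._< suc (suc k) ℕ.* suc d) (sym (ℕ.*-identityʳ (suc k)))
    (ℕ.m≤m*n (suc (suc k)) (suc d))))
archimedean (mkℚ (int 0)    d c) = 1 , *<* (ℤ.+<+ (ℕ.s≤s ℕ.z≤n))
archimedean (mkℚ -[1+ k ] d c) = 0 , *<* ℤ.-<+

+-cancelʳ-< : ∀ r {p q} → p + r < q + r → p < q
+-cancelʳ-< r {p} {q} lt = ≰⇒> λ q≤p → <-irrefl refl (<-≤-trans lt (+-monoˡ-≤ r q≤p))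

partialSum-mono : ∀ {a b} → (∀ k → a k ≤ b k) → ∀ m → partialSum a m ≤ partialSum b m
partialSum-mono a≤b zero    = ≤-refl
partialSum-mono a≤b (suc m) = +-mono-≤ (partialSum-mono a≤b m) (a≤b m)

partialSum-cong : ∀ {a b} → (∀ k → a k ≡ b k) → ∀ m → partialSum a m ≡ partialSum b m
partialSum-cong a≡b zero    = refl
partialSum-cong a≡b (suc m) = cong₂ _+_ (partialSum-cong a≡b m) (a≡b m)

sum-zero : ∀ {n} {f : Fin n → ℚ} → (∀ i → f i ≡ 0ℚ) → sum f ≡ 0ℚ
sum-zero {zero}  f≡0 = refl
sum-zero {suc n} f≡0 = cong₂ _+_ (f≡0 zero) (sum-zero (f≡0 ∘ suc))

module Iteration {X : Set} {n : ℕ} (q : X → Fin n → ℚ) (next : X → Fin n → X)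
                 (0≤q : ∀ x i → 0ℚ ≤ q x i) where

  T : (X → ℚ) → X → ℚ
  T f x = sum (λ i → q x i * f (next x i))

  T-mono : ∀ {f g} → (∀ x → f x ≤ g x) → ∀ x → T f x ≤ T g x
  T-mono f≤g x = sum-mono-≤ λ i → *-monoˡ-≤ (0≤q x i) (f≤g (next x i))

  T-cong : ∀ {f g} → (∀ x → f x ≡ g x) → ∀ x → T f x ≡ T g x
  T-cong f≡g x = sum-cong-≗ λ i → cong (q x i *_) (f≡g (next x i))

  T-+ : ∀ f g x → T (λ y → f y + g y) x ≡ T f x + T g x
  T-+ f g x = trans (sum-cong-≗ λ i → *-distribˡ-+ (q x i) (f (next x i)) (g (next x i)))
    (∑-distrib-+ (λ i → q x i * f (next x i)) (λ i → q x i * g (next x i)))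

  T-* : ∀ c f x → T (λ y → c * f y) x ≡ c * T f x
  T-* c f x = trans
    (sum-cong-≗ λ i → solve 3 (λ r c y → r :* (c :* y) := c :* (r :* y)) refl (q x i) c (f (next x i)))
    (sym (*-distribˡ-sum c (λ i → q x i * f (next x i))))

  T-zero : ∀ x → T (λ _ → 0ℚ) x ≡ 0ℚ
  T-zero x = sum-zero λ i → *-zeroʳ (q x i)

  0≤T : ∀ {f} → (∀ x → 0ℚ ≤ f x) → ∀ x → 0ℚ ≤ T f x
  0≤T 0≤f x = sum-nonNeg λ i → 0≤p*q (0≤q x i) (0≤f (next x i))

  iterate : (X → ℚ) → ℕ → X → ℚ
  iterate β zero    = β
  iterate β (suc k) = T (iterate β k)

  0≤iterate : ∀ {β} → (∀ x → 0ℚ ≤ β x) → ∀ k x → 0ℚ ≤ iterate β k x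
  0≤iterate 0≤β zero    = 0≤β
  0≤iterate 0≤β (suc k) = 0≤T (0≤iterate 0≤β k)

  neumann : (X → ℚ) → ℕ → X → ℚ
  neumann β m x = partialSum (λ k → iterate β k x) m

  neumann-suc : ∀ β m x → neumann β (suc m) x ≡ β x + T (neumann β m) x
  neumann-suc β zero    x = trans (+-comm 0ℚ (β x)) (cong (β x +_) (sym (T-zero x)))
  neumann-suc β (suc m) x = begin
    neumann β (suc m) x + T (iterate β m) x             ≡⟨ cong (_+ T (iterate β m) x) (neumann-suc β m x) ⟩
    β x + T (neumann β m) x + T (iterate β m) x         ≡⟨ +-assoc (β x) _ _ ⟩
    β x + (T (neumann β m) x + T (iterate β m) x)       ≡⟨ cong (β x +_) (T-+ (neumann β m) (iterate β m) x) ⟨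
    β x + T (neumann β (suc m)) x                       ∎
    where open ≡-Reasoning

  module Limit
    (T1≤1 : ∀ x → T (λ _ → 1ℚ) x ≤ 1ℚ)
    {β h G : X → ℚ} {K : ℚ}
    (0≤h : ∀ x → 0ℚ ≤ h x) (h-eq : ∀ x → h x ≡ β x + T h x)
    (h≤K : ∀ x → h x ≤ K) (0≤K : 0ℚ ≤ K)
    (0≤G : ∀ x → 0ℚ ≤ G x) (G-eq : ∀ x → G x ≡ 1ℚ + T G x)
    where

    remainder : ∀ m x → h x ≡ neumann β m x + iterate h m x
    remainder zero    x = sym (+-identityˡ (h x))
    remainder (suc m) x = begin
      h x                                                  ≡⟨ h-eq x ⟩
      β x + T h x                                          ≡⟨ cong (β x +_) (T-cong (remainder m) x) ⟩
      β x + T (λ y → neumann β m y + iterate h m y) x      ≡⟨ cong (β x +_) (T-+ (neumann β m) (iterate h m) x) ⟩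
      β x + (T (neumann β m) x + T (iterate h m) x)        ≡⟨ +-assoc (β x) _ _ ⟨
      β x + T (neumann β m) x + T (iterate h m) x          ≡⟨ cong (_+ T (iterate h m) x) (neumann-suc β m x) ⟨
      neumann β (suc m) x + iterate h (suc m) x            ∎
      where open ≡-Reasoning

    neumann≤h : ∀ m x → neumann β m x ≤ h x
    neumann≤h m x = subst (neumann β m x ≤_) (sym (remainder m x)) (p≤p+q (0≤iterate 0≤h m x))

    iterate≤K : ∀ m x → iterate h m x ≤ K
    iterate≤K zero    x = h≤K x
    iterate≤K (suc m) x = begin
      T (iterate h m) x        ≤⟨ T-mono (iterate≤K m) x ⟩
      T (λ _ → K) x            ≡⟨ T-cong (λ _ → sym (*-identityʳ K)) x ⟩
      T (λ _ → K * 1ℚ) x       ≡⟨ T-* K (λ _ → 1ℚ) x ⟩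
      K * T (λ _ → 1ℚ) x       ≤⟨ *-monoˡ-≤ 0≤K (T1≤1 x) ⟩
      K * 1ℚ                   ≡⟨ *-identityʳ K ⟩
      K                        ∎
      where open ≤-Reasoning

    -- G is the expected lifetime of the walk, so the remainder is O(1/m).
    remainder-bound : ∀ m x → fromℕ m * iterate h m x ≤ K * G x
    remainder-bound zero    x = subst (_≤ K * G x) (sym (*-zeroˡ (h x))) (0≤p*q 0≤K (0≤G x))
    remainder-bound (suc m) x = begin
      fromℕ (suc m) * e                                ≡⟨ cong (_* e) (fromℕ-suc m) ⟩
      (1ℚ + fromℕ m) * e                               ≡⟨ *-distribʳ-+ e 1ℚ (fromℕ m) ⟩
      1ℚ * e + fromℕ m * e                             ≡⟨ cong₂ _+_ (*-identityˡ e) (sym (T-* (fromℕ m) (iterate h m) x)) ⟩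
      e + T (λ y → fromℕ m * iterate h m y) x          ≤⟨ +-mono-≤ (iterate≤K (suc m) x) (T-mono (remainder-bound m) x) ⟩
      K + T (λ y → K * G y) x                          ≡⟨ cong₂ _+_ (sym (*-identityʳ K)) (T-* K G x) ⟩
      K * 1ℚ + K * T G x                               ≡⟨ *-distribˡ-+ K 1ℚ (T G x) ⟨
      K * (1ℚ + T G x)                                 ≡⟨ cong (K *_) (G-eq x) ⟨
      K * G x                                          ∎
      where open ≤-Reasoning
            e = iterate h (suc m) x

    neumann-approaches : ∀ {p} x → p < h x → ∃[ m ] p < neumann β m x
    neumann-approaches {p} x p<h =
      let ε = h x - p
          δ , 0<δ , ε*δ≡1 = inverse (p<q⇒0<q-p p<h)
          m , lt = archimedean (K * G x * δ)
          open ≤-Reasoning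
          e = iterate h m x
          e<ε : e < ε
          e<ε = *-cancelˡ-<-nonNeg (fromℕ m) (begin-strict
            fromℕ m * e        ≤⟨ remainder-bound m x ⟩
            K * G x            ≡⟨ *-identityʳ (K * G x) ⟨
            K * G x * 1ℚ       ≡⟨ cong (K * G x *_) ε*δ≡1 ⟨
            K * G x * (ε * δ)  ≡⟨ solve 3 (λ k e d → k :* (e :* d) := e :* (k :* d)) refl (K * G x) ε δ ⟩
            ε * (K * G x * δ)  <⟨ *-monoʳ-< (p<q⇒0<q-p p<h) lt ⟩
            ε * fromℕ m        ≡⟨ *-comm ε (fromℕ m) ⟩
            fromℕ m * ε        ∎)
      in m , +-cancelʳ-< e (begin-strict
            p + e                ≡⟨ +-comm p e ⟩
            e + p                <⟨ +-monoˡ-< p e<ε ⟩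
            h x - p + p          ≡⟨ +-assoc (h x) (- p) p ⟩
            h x + (- p + p)      ≡⟨ cong (h x +_) (+-inverseˡ p) ⟩
            h x + 0ℚ             ≡⟨ +-identityʳ (h x) ⟩
            h x                  ≡⟨ remainder m x ⟩
            neumann β m x + e    ∎)

    limit-mono : ∀ {x y} → (∀ k → iterate β k x ≤ iterate β k y) → h x ≤ h y
    limit-mono {x} {y} x≤y = ≮⇒≥ λ hy<hx → let m , lt = neumann-approaches x hy<hx in
      <-irrefl refl (<-≤-trans lt (≤-trans (partialSum-mono x≤y m) (neumann≤h m y)))

bound-Fin : ∀ {n} (f : Fin n → ℚ) → ∃[ K ] (∀ i → f i ≤ K)
bound-Fin {zero}  f = 0ℚ , λ ()
bound-Fin {suc n} f =
  let K , f≤K = bound-Fin (f ∘ suc)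
  in f zero ⊔ K , λ { zero → p≤p⊔q (f zero) K ; (suc i) → ≤-trans (f≤K i) (p≤q⊔p (f zero) K) }

bound-Subset : ∀ {n} (f : Subset n → ℚ) → ∃[ K ] (∀ S → f S ≤ K)
bound-Subset {zero}  f = f [] , λ { [] → ≤-refl }
bound-Subset {suc n} f =
  let K₁ , le₁ = bound-Subset (f ∘ (inside ∷_))
      K₂ , le₂ = bound-Subset (f ∘ (outside ∷_))
  in K₁ ⊔ K₂ , λ { (true  ∷ S) → ≤-trans (le₁ S) (p≤p⊔q K₁ K₂)
                 ; (false ∷ S) → ≤-trans (le₂ S) (p≤q⊔p K₁ K₂) }

bound : ∀ {n} (f : Subset n × Fin n → ℚ) → ∃[ K ] (0ℚ ≤ K × (∀ x → f x ≤ K))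
bound f =
  let K , le = bound-Subset (λ S → proj₁ (bound-Fin (λ a → f (S , a))))
  in 0ℚ ⊔ K , p≤p⊔q 0ℚ K ,
     λ (S , a) → ≤-trans (proj₂ (bound-Fin (λ a → f (S , a))) a) (≤-trans (le S) (p≤q⊔p 0ℚ K))

∪-absorbs-∈ : ∀ {n} {S : Subset n} {a} → a ∈ S → S ∪ ⁅ a ⁆ ≡ S
∪-absorbs-∈ {S = S} {a} a∈S = ⊆-antisym
  (λ x∈ → [ id , (λ x∈⁅a⁆ → subst (_∈ S) (sym (x∈⁅y⁆⇒x≡y a x∈⁅a⁆)) a∈S) ]′ (x∈p∪q⁻ S ⁅ a ⁆ x∈))
  (p⊆p∪q ⁅ a ⁆)

∣S∣<∣S∪⁅a⁆∣ : ∀ {n} {S : Subset n} {a} → a ∉ S → ∣ S ∣ ℕ.< ∣ S ∪ ⁅ a ⁆ ∣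
∣S∣<∣S∪⁅a⁆∣ {S = S} {a} a∉S = p⊂q⇒∣p∣<∣q∣ (p⊆p∪q ⁅ a ⁆ , a , q⊆p∪q S ⁅ a ⁆ (x∈⁅x⁆ a) , a∉S)

-- The walk together with the set of vertices visited before the current one.

module VisitedSet {n : ℕ} (Q : Fin n → Fin n → ℚ) (0≤Q : ∀ a b → 0ℚ ≤ Q a b)
                  (g : Fin n → ℚ) (0≤g : ∀ a → 0ℚ ≤ g a)
                  (Qg<g : ∀ a → sum (λ b → Q a b * g b) < g a) where

  State : Set
  State = Subset n × Fin n

  next : State → Fin n → State
  next (S , a) b = S ∪ ⁅ a ⁆ , b

  open Iteration {State} (Q ∘ proj₂) next (0≤Q ∘ proj₂) public

  module _ (β : State → ℚ) (0≤β : ∀ x → 0ℚ ≤ β x) where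

    -- The visited set never shrinks, so the equations can be solved by
    -- induction on the number of unvisited vertices; only the equations with
    -- a ∈ S have both sides at the same S.

    module Layer (h : State → ℚ) (0≤h : ∀ x → 0ℚ ≤ h x) (S : Subset n) where

      Qˢ : Fin n → Fin n → ℚ
      Qˢ a b = if does (a ∈? S) then Q a b else 0ℚ

      rˢ : Fin n → ℚ
      rˢ a = β (S , a) + (if does (a ∈? S) then 0ℚ else T h (S , a))

      0≤Qˢ : ∀ a b → 0ℚ ≤ Qˢ a b
      0≤Qˢ a b with does (a ∈? S)
      ... | true  = 0≤Q a b
      ... | false = ≤-refl

      0≤rˢ : ∀ a → 0ℚ ≤ rˢ a
      0≤rˢ a with does (a ∈? S)
      ... | true  = 0≤p+q (0≤β (S , a)) ≤-refl
      ... | false = 0≤p+q (0≤β (S , a)) (0≤T 0≤h (S , a))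

      Qˢ≤Q : ∀ a b → Qˢ a b ≤ Q a b
      Qˢ≤Q a b with does (a ∈? S)
      ... | true  = ≤-refl
      ... | false = 0≤Q a b

      Qˢg<g : ∀ a → sum (λ b → Qˢ a b * g b) < g a
      Qˢg<g a = ≤-<-trans
        (sum-mono-≤ λ b → *-monoʳ-≤-nonNeg (g b) {{nonNegative (0≤g b)}} (Qˢ≤Q a b))
        (Qg<g a)

      solution = solve-nonNeg n Qˢ rˢ g 0≤Qˢ 0≤rˢ 0≤g Qˢg<g

      f : Fin n → ℚ
      f = proj₁ solution

      0≤f : ∀ a → 0ℚ ≤ f a
      0≤f = proj₁ (proj₂ solution)

      f-∈ : ∀ {a} → a ∈ S → f a ≡ β (S , a) + sum (λ b → Q a b * f b)
      f-∈ {a} a∈S with a ∈? S | proj₂ (proj₂ solution) a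
      ... | yes _   | eq = trans eq (cong (_+ sum (λ b → Q a b * f b)) (+-identityʳ (β (S , a))))
      ... | no a∉S | _  = contradiction a∈S a∉S

      f-∉ : ∀ {a} → a ∉ S → f a ≡ β (S , a) + T h (S , a)
      f-∉ {a} a∉S with a ∈? S | proj₂ (proj₂ solution) a
      ... | yes a∈S | _  = contradiction a∈S a∉S
      ... | no _    | eq = trans eq (trans
        (cong (β (S , a) + T h (S , a) +_) (sum-zero λ b → *-zeroˡ (f b)))
        (+-identityʳ _))

    solve-≥ : ∀ j → ∃ λ (h : State → ℚ) → (∀ x → 0ℚ ≤ h x) ×
      (∀ S a → n ℕ.< j ℕ.+ ∣ S ∣ → h (S , a) ≡ β (S , a) + T h (S , a))
    solve-≥ zero    = (λ _ → 0ℚ) , (λ _ → ≤-refl) , λ S a n<∣S∣ → contradiction (∣p∣≤n S) (ℕ.<⇒≱ n<∣S∣)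
    solve-≥ (suc j) = h′ , 0≤h′ , h′-eq
      where
      h = proj₁ (solve-≥ j)
      0≤h = proj₁ (proj₂ (solve-≥ j))
      h-eq = proj₂ (proj₂ (solve-≥ j))
      open Layer h 0≤h

      old? : ∀ S → Dec (n ℕ.< j ℕ.+ ∣ S ∣)
      old? S = n ℕ.<? j ℕ.+ ∣ S ∣

      h′ : State → ℚ
      h′ (S , a) = if does (old? S) then h (S , a) else f S a

      h′-old : ∀ {S a} → n ℕ.< j ℕ.+ ∣ S ∣ → h′ (S , a) ≡ h (S , a)
      h′-old {S} {a} lt = cong (if_then h (S , a) else f S a) (dec-true (old? S) lt)

      h′-new : ∀ {S a} → ¬ (n ℕ.< j ℕ.+ ∣ S ∣) → h′ (S , a) ≡ f S a
      h′-new {S} {a} ≮ = cong (if_then h (S , a) else f S a) (dec-false (old? S) ≮)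

      0≤h′ : ∀ x → 0ℚ ≤ h′ x
      0≤h′ (S , a) with does (old? S)
      ... | true  = 0≤h (S , a)
      ... | false = 0≤f S a

      T-old : ∀ {S a} → n ℕ.< j ℕ.+ ∣ S ∪ ⁅ a ⁆ ∣ → T h′ (S , a) ≡ T h (S , a)
      T-old {S} {a} lt = sum-cong-≗ λ b → cong (Q a b *_) (h′-old lt)

      h′-eq : ∀ S a → n ℕ.< suc j ℕ.+ ∣ S ∣ → h′ (S , a) ≡ β (S , a) + T h′ (S , a)
      h′-eq S a n≤ with old? S | a ∈? S
      ... | yes lt | _ = begin
        h′ (S , a)                ≡⟨ h′-old lt ⟩
        h (S , a)                 ≡⟨ h-eq S a lt ⟩
        β (S , a) + T h (S , a)  
          ≡⟨ cong (β (S , a) +_) (T-old (ℕ.<-≤-trans lt (ℕ.+-monoʳ-≤ j (∣p∣≤∣p∪q∣ S ⁅ a ⁆)))) ⟨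
        β (S , a) + T h′ (S , a)  ∎
        where open ≡-Reasoning
      ... | no ≮ | yes a∈S = begin
        h′ (S , a)                               ≡⟨ h′-new ≮ ⟩
        f S a                                    ≡⟨ f-∈ S a∈S ⟩
        β (S , a) + sum (λ b → Q a b * f S b)
          ≡⟨ cong (β (S , a) +_) (sum-cong-≗ λ b → cong (Q a b *_)
               (trans (cong (λ R → h′ (R , b)) (∪-absorbs-∈ a∈S)) (h′-new ≮))) ⟨
        β (S , a) + T h′ (S , a)                 ∎
        where open ≡-Reasoning
      ... | no ≮ | no a∉S = begin
        h′ (S , a)                ≡⟨ h′-new ≮ ⟩
        f S a                     ≡⟨ f-∉ S a∉S ⟩
        β (S , a) + T h (S , a)   ≡⟨ cong (β (S , a) +_) (T-old (ℕ.<-≤-trans n≤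
               (subst (ℕ._≤ j ℕ.+ ∣ S ∪ ⁅ a ⁆ ∣) (ℕ.+-suc j ∣ S ∣) (ℕ.+-monoʳ-≤ j (∣S∣<∣S∪⁅a⁆∣ a∉S))))) ⟨
        β (S , a) + T h′ (S , a)  ∎
        where open ≡-Reasoning

    fixedPoint : ∃ λ (h : State → ℚ) → (∀ x → 0ℚ ≤ h x) × (∀ x → h x ≡ β x + T h x)
    fixedPoint = let h , 0≤h , h-eq = solve-≥ (suc n)
      in h , 0≤h , λ (S , a) → h-eq S a (ℕ.s≤s (ℕ.m≤m+n n ∣ S ∣))

sum-indicator : ∀ {A : Set} {P : Pred A 0ℓ} (P? : Decidable P) c {m} (f : Fin m → A) →
  sum (λ i → if does (P? (f i)) then c else 0ℚ) ≡ fromℕ (Vec.count P? (Vec.tabulate f)) * c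
sum-indicator P? c {zero}  f = sym (*-zeroˡ c)
sum-indicator P? c {suc m} f with does (P? (f zero)) | sum-indicator P? c (f ∘ suc)
... | true  | ih = begin
  c + sum (λ i → if does (P? (f (suc i))) then c else 0ℚ)   ≡⟨ cong₂ _+_ (sym (*-identityˡ c)) ih ⟩
  1ℚ * c + fromℕ k * c                                      ≡⟨ *-distribʳ-+ c 1ℚ (fromℕ k) ⟨
  (1ℚ + fromℕ k) * c                                        ≡⟨ cong (_* c) (fromℕ-suc k) ⟨
  fromℕ (suc k) * c                                         ∎
  where open ≡-Reasoning
        k = Vec.count P? (Vec.tabulate (f ∘ suc))
... | false | ih = trans (+-identityˡ _) ih

count-tabulate≢0 : ∀ {A : Set} {P : Pred A 0ℓ} (P? : Decidable P) {m} (f : Fin m → A) i →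
  P (f i) → Vec.count P? (Vec.tabulate f) ≢ 0
count-tabulate≢0 P? f zero    p eq with P? (f zero)
count-tabulate≢0 P? f zero    p () | yes _
... | no ¬p = ¬p p
count-tabulate≢0 P? f (suc i) p eq with does (P? (f zero))
count-tabulate≢0 P? f (suc i) p () | true
... | false = count-tabulate≢0 P? (f ∘ suc) i p eq

sum-δ : ∀ {n} (u : Fin n) (f : Fin n → ℚ) → sum (λ a → if does (a ≟ u) then f a else 0ℚ) ≡ f u
sum-δ {suc n} zero f = trans (cong (f zero +_) (sum-zero {n} λ _ → refl)) (+-identityʳ (f zero))
sum-δ (suc u)      f = trans (+-identityˡ _) (sum-δ u (f ∘ suc))

uniform : ∀ {n} {P : ℕ → Fin n → Set} → (∀ {m m′ i} → m ℕ.≤ m′ → P m i → P m′ i) →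
  (∀ i → ∃[ m ] P m i) → ∃[ N ] (∀ i → P N i)
uniform {zero}  mono ex = 0 , λ ()
uniform {suc n} {P} mono ex =
  let N , p = uniform {P = λ m i → P m (suc i)} mono (ex ∘ suc)
      m , q = ex zero
  in m ℕ.⊔ N , λ { zero → mono (ℕ.m≤m⊔n m N) q ; (suc i) → mono (ℕ.m≤n⊔m m N) (p i) }

sumOver : ∀ {A : Set} → List A → (A → ℚ) → ℚ
sumOver xs f = sumℚ (List.map f xs)

sumOver-cong : ∀ {A : Set} {f g : A → ℚ} → (∀ x → f x ≡ g x) → ∀ xs → sumOver xs f ≡ sumOver xs g
sumOver-cong f≡g []       = refl
sumOver-cong f≡g (x ∷ xs) = cong₂ _+_ (f≡g x) (sumOver-cong f≡g xs)

sumOver-zero : ∀ {A : Set} (xs : List A) → sumOver xs (λ _ → 0ℚ) ≡ 0ℚ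
sumOver-zero []       = refl
sumOver-zero (x ∷ xs) = trans (+-identityˡ _) (sumOver-zero xs)

sumOver-* : ∀ {A : Set} c (f : A → ℚ) xs → sumOver xs (λ x → c * f x) ≡ c * sumOver xs f
sumOver-* c f []       = sym (*-zeroʳ c)
sumOver-* c f (x ∷ xs) = trans (cong (c * f x +_) (sumOver-* c f xs)) (sym (*-distribˡ-+ c (f x) _))

sumOver-++ : ∀ {A : Set} (f : A → ℚ) xs ys → sumOver (xs ++ ys) f ≡ sumOver xs f + sumOver ys f
sumOver-++ f []       ys = sym (+-identityˡ _)
sumOver-++ f (x ∷ xs) ys = trans (cong (f x +_) (sumOver-++ f xs ys)) (sym (+-assoc (f x) _ _))

sumOver-filter : ∀ {A : Set} {P : Pred A 0ℓ} (P? : Decidable P) f xs →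
  sumOver (List.filter P? xs) f ≡ sumOver xs (λ x → if does (P? x) then f x else 0ℚ)
sumOver-filter P? f []       = refl
sumOver-filter P? f (x ∷ xs) with does (P? x)
... | true  = cong (f x +_) (sumOver-filter P? f xs)
... | false = trans (sumOver-filter P? f xs) (sym (+-identityˡ _))

sumOver-product : ∀ {A B C : Set} (_⊗_ : A → B → C) (f : C → ℚ) {m} (e : Fin m → A) ys →
  sumOver (List.cartesianProductWith _⊗_ (List.tabulate e) ys) f ≡ sum (λ i → sumOver ys (λ y → f (e i ⊗ y)))
sumOver-product _⊗_ f {zero}  e ys = refl
sumOver-product _⊗_ f {suc m} e ys = trans
  (sumOver-++ f (List.map (e zero ⊗_) ys) _)
  (cong₂ _+_ (cong sumℚ (sym (map-∘ ys))) (sumOver-product _⊗_ f (e ∘ suc) ys))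

∈-init⊎last : ∀ {A : Set} {k} {x : A} (w : Vec A (suc k)) → x Vec.∈ w → x Vec.∈ init w ⊎ x ≡ last w
∈-init⊎last (a ∷ [])    (here x≡a)  = inj₂ x≡a
∈-init⊎last (a ∷ b ∷ w) (here x≡a)  = inj₁ (here x≡a)
∈-init⊎last (a ∷ b ∷ w) (there x∈w) = ⊎-map there id (∈-init⊎last (b ∷ w) x∈w)

module _ {n : ℕ} (G : Digraph n) (connected : Connected G) (v : Fin n) where
  open Digraph G

  P : Fin n → Fin n → ℚ
  P a b = if does (a ⟶? b) then recip (outdegree G a) else 0ℚ

  -- The walk is killed on reaching v.

  Q : Fin n → Fin n → ℚ
  Q a b = if does (a ≟ v) then 0ℚ else P a b

  P-edge : ∀ {a b} → a ⟶ b → P a b ≡ recip (outdegree G a)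
  P-edge {a} {b} e = cong (if_then recip (outdegree G a) else 0ℚ) (dec-true (a ⟶? b) e)

  Q-edge : ∀ {a b} → a ≢ v → a ⟶ b → Q a b ≡ recip (outdegree G a)
  Q-edge {a} {b} a≢v e = trans (cong (if_then 0ℚ else P a b) (dec-false (a ≟ v) a≢v)) (P-edge e)

  Q-v : ∀ {a} b → a ≡ v → Q a b ≡ 0ℚ
  Q-v {a} b a≡v = cong (if_then 0ℚ else P a b) (dec-true (a ≟ v) a≡v)

  Q-nonEdge : ∀ {a b} → ¬ (a ⟶ b) → Q a b ≡ 0ℚ
  Q-nonEdge {a} {b} ¬e with does (a ≟ v)
  ... | true  = refl
  ... | false = cong (if_then recip (outdegree G a) else 0ℚ) (dec-false (a ⟶? b) ¬e)

  outdegree≢0 : ∀ {a b} → a ⟶ b → outdegree G a ≢ 0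
  outdegree≢0 {a} {b} e = count-tabulate≢0 (a ⟶?_) id b e

  0<recip : ∀ {d} → d ≢ 0 → 0ℚ < recip d
  0<recip {zero}  d≢0 = contradiction refl d≢0
  0<recip {suc d} _   = positive⁻¹ (recip (suc d)) {{normalize-pos 1 (suc d)}}

  0<Q : ∀ {a b} → a ≢ v → a ⟶ b → 0ℚ < Q a b
  0<Q a≢v e = subst (0ℚ <_) (sym (Q-edge a≢v e)) (0<recip (outdegree≢0 e))

  0≤P : ∀ a b → 0ℚ ≤ P a b
  0≤P a b with does (a ⟶? b)
  ... | true  = 0≤recip (outdegree G a)
  ... | false = ≤-refl

  0≤Q : ∀ a b → 0ℚ ≤ Q a b
  0≤Q a b with does (a ≟ v)
  ... | true  = ≤-refl
  ... | false = 0≤P a b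

  sum-P : ∀ a → sum (P a) ≡ fromℕ (outdegree G a) * recip (outdegree G a)
  sum-P a = sum-indicator (a ⟶?_) (recip (outdegree G a)) id

  sum-P≤1 : ∀ a → sum (P a) ≤ 1ℚ
  sum-P≤1 a = subst (_≤ 1ℚ) (sym (sum-P a)) (aux (outdegree G a))
    where
    aux : ∀ d → fromℕ d * recip d ≤ 1ℚ
    aux zero    = nonNegative⁻¹ 1ℚ
    aux (suc d) = ≤-reflexive (fromℕ*recip d)

  sum-Q≤1 : ∀ a → sum (Q a) ≤ 1ℚ
  sum-Q≤1 a with a ≟ v
  ... | yes a≡v = subst (_≤ 1ℚ) (sym (sum-zero {n} λ _ → refl)) (nonNegative⁻¹ 1ℚ)
  ... | no a≢v  = sum-P≤1 a

  sum-Q≡1 : ∀ {a b} → a ≢ v → a ⟶ b → sum (Q a) ≡ 1ℚ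
  sum-Q≡1 {a} {b} a≢v e = trans
    (sum-cong-≗ λ c → cong (if_then 0ℚ else P a c) (dec-false (a ≟ v) a≢v))
    (trans (sum-P a) (aux (outdegree≢0 e)))
    where
    aux : ∀ {d} → d ≢ 0 → fromℕ d * recip d ≡ 1ℚ
    aux {zero}  d≢0 = contradiction refl d≢0
    aux {suc d} _   = fromℕ*recip d

  module Killed = Iteration {Fin n} Q (λ _ b → b) 0≤Q

  one : Fin n → ℚ
  one _ = 1ℚ

  Killed-T1≤1 : ∀ a → Killed.T one a ≤ 1ℚ
  Killed-T1≤1 a = subst (_≤ 1ℚ) (sum-cong-≗ λ b → sym (*-identityʳ (Q a b))) (sum-Q≤1 a)

  survival : ℕ → Fin n → ℚ
  survival = Killed.iterate one

  0≤survival : ∀ m a → 0ℚ ≤ survival m a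
  0≤survival = Killed.0≤iterate (λ _ → nonNegative⁻¹ 1ℚ)

  survival-suc : ∀ m a → survival (suc m) a ≤ survival m a
  survival-suc zero    a = Killed-T1≤1 a
  survival-suc (suc m) a = Killed.T-mono (survival-suc m) a

  survival-antitone : ∀ {m m′} a → m ℕ.≤ m′ → survival m′ a ≤ survival m a
  survival-antitone {m} {zero}  a ℕ.z≤n = ≤-refl
  survival-antitone {m} {suc m′} a m≤ with ℕ.m≤n⇒m<n∨m≡n m≤
  ... | inj₁ m<  = ≤-trans (survival-suc m′ a) (survival-antitone a (ℕ.s≤s⁻¹ m<))
  ... | inj₂ refl = ≤-refl

  survival-v : ∀ m {a} → a ≡ v → survival (suc m) a < 1ℚ
  survival-v m {a} a≡v = subst (_< 1ℚ)
    (sym (sum-zero λ b → trans (cong (_* survival m b) (Q-v b a≡v)) (*-zeroˡ (survival m b))))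
    (positive⁻¹ 1ℚ)

  survival<1 : ∀ {a} → Star _⟶_ a v → ∃[ m ] survival m a < 1ℚ
  survival<1 ε = 1 , survival-v 0 refl
  survival<1 {a} (_◅_ {j = b} e es) with survival<1 es | a ≟ v
  ... | m , lt | yes a≡v = suc m , survival-v m a≡v
  ... | m , lt | no a≢v  = suc m , <-≤-trans
    (sum-mono-< (λ c → *-monoˡ-≤ (0≤Q a c) (survival-antitone c (ℕ.z≤n {m})))
                b (*-monoʳ-< (0<Q a≢v e) lt))
    (Killed-T1≤1 a)

  survival-horizon : ∃[ N ] (∀ a → survival N a < 1ℚ)
  survival-horizon = uniform
    (λ m≤ lt → ≤-<-trans (survival-antitone _ m≤) lt) (λ a → survival<1 (connected a v))

  -- With s the sum of the first N survival probabilities, T s = s − 1 +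
  -- survival N < s, so s is a test vector for the elimination.

  truncatedLifetime : Fin n → ℚ
  truncatedLifetime = Killed.neumann one (proj₁ survival-horizon)

  0≤truncatedLifetime : ∀ a → 0ℚ ≤ truncatedLifetime a
  0≤truncatedLifetime a = partialSum-nonNeg (λ k → 0≤survival k a) (proj₁ survival-horizon)
    where
    partialSum-nonNeg : ∀ {a} → (∀ k → 0ℚ ≤ a k) → ∀ m → 0ℚ ≤ partialSum a m
    partialSum-nonNeg 0≤a zero    = ≤-refl
    partialSum-nonNeg 0≤a (suc m) = 0≤p+q (partialSum-nonNeg 0≤a m) (0≤a m)

  T-truncatedLifetime< : ∀ a → Killed.T truncatedLifetime a < truncatedLifetime a
  T-truncatedLifetime< a = +-cancelʳ-< 1ℚ (begin-strict
    Killed.T truncatedLifetime a + 1ℚ           ≡⟨ +-comm (Killed.T truncatedLifetime a) 1ℚ ⟩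
    1ℚ + Killed.T truncatedLifetime a           ≡⟨ Killed.neumann-suc one (proj₁ survival-horizon) a ⟨
    truncatedLifetime a + survival (proj₁ survival-horizon) a  <⟨ +-monoʳ-< (truncatedLifetime a) (proj₂ survival-horizon a) ⟩
    truncatedLifetime a + 1ℚ             ∎)
    where open ≤-Reasoning

  open VisitedSet Q 0≤Q truncatedLifetime 0≤truncatedLifetime T-truncatedLifetime< public

  Final : Pred State 0ℓ
  Final (A , a) = a ≡ v × (∀ x → x ∈ A ∪ ⁅ a ⁆)

  final? : Decidable Final
  final? (A , a) = (a ≟ v) ×-dec all? (λ x → x ∈? A ∪ ⁅ a ⁆)

  β : State → ℚ
  β x = if does (final? x) then 1ℚ else 0ℚ

  β-final : ∀ {x} → Final x → β x ≡ 1ℚ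
  β-final {x} p = cong (if_then 1ℚ else 0ℚ) (dec-true (final? x) p)

  β-nonFinal : ∀ {x} → ¬ Final x → β x ≡ 0ℚ
  β-nonFinal {x} ¬p = cong (if_then 1ℚ else 0ℚ) (dec-false (final? x) ¬p)

  0≤β : ∀ x → 0ℚ ≤ β x
  0≤β x with does (final? x)
  ... | true  = nonNegative⁻¹ 1ℚ
  ... | false = ≤-refl

  ∪-monoˡ : ∀ {A B C : Subset n} → A ⊆ B → A ∪ C ⊆ B ∪ C
  ∪-monoˡ {A} {B} {C} A⊆B x∈ = x∈p∪q⁺ (⊎-map A⊆B id (x∈p∪q⁻ A C x∈))

  β-mono : ∀ {A B} a → A ⊆ B → β (A , a) ≤ β (B , a)
  β-mono {A} {B} a A⊆B = case final? (A , a) of λ where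
    (no ¬fin)         → ≤-trans (≤-reflexive (β-nonFinal ¬fin)) (0≤β (B , a))
    (yes (a≡v , cov)) → ≤-reflexive (trans (β-final (a≡v , cov))
                          (sym (β-final (a≡v , λ x → ∪-monoˡ {A} A⊆B (cov x)))))

  iterate-mono : ∀ k {A B} a → A ⊆ B → iterate β k (A , a) ≤ iterate β k (B , a)
  iterate-mono zero    a A⊆B = β-mono a A⊆B
  iterate-mono (suc k) {A} a A⊆B = sum-mono-≤ λ b → *-monoˡ-≤ (0≤Q a b) (iterate-mono k b (∪-monoˡ {A} A⊆B))

  data Tour : ∀ {k} → Subset n → Vec (Fin n) (suc k) → Set where
    stop : ∀ {A a} → Final (A , a) → Tour A (a ∷ [])
    step : ∀ {A a b k} {w : Vec (Fin n) k} → a ≢ v → a ⟶ b → Tour (A ∪ ⁅ a ⁆) (b ∷ w) → Tour A (a ∷ b ∷ w)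

  mass : ∀ {k} → State → Vec (Fin n) k → ℚ
  mass x []      = β x
  mass x (b ∷ w) = Q (proj₂ x) b * mass (next x b) w

  mass-tour : ∀ {k A a} {w : Vec (Fin n) k} → Tour A (a ∷ w) → mass (A , a) w ≡ weight G (a ∷ w)
  mass-tour (stop fin)       = β-final fin
  mass-tour (step a≢v e t) = cong₂ _*_ (Q-edge a≢v e) (mass-tour t)

  mass-nonTour : ∀ {k A a} (w : Vec (Fin n) k) → ¬ Tour A (a ∷ w) → mass (A , a) w ≡ 0ℚ
  mass-nonTour [] ¬t = β-nonFinal (¬t ∘ stop)
  mass-nonTour {A = A} {a} (b ∷ w) ¬t with a ≟ v
  ... | yes _ = *-zeroˡ (mass (A ∪ ⁅ a ⁆ , b) w)
  ... | no a≢v with a ⟶? b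
  ...   | no _  = *-zeroˡ (mass (A ∪ ⁅ a ⁆ , b) w)
  ...   | yes e = trans (cong (recip (outdegree G a) *_) (mass-nonTour w (¬t ∘ step a≢v e)))
                          (*-zeroʳ (recip (outdegree G a)))

  sum-mass : ∀ k x → sumOver (sequences G k) (mass x) ≡ iterate β k x
  sum-mass zero    x = +-identityʳ (β x)
  sum-mass (suc k) x = trans
    (sumOver-product _∷_ (mass x) id (sequences G k))
    (sum-cong-≗ λ b → trans (sumOver-* (Q (proj₂ x) b) (mass (next x b)) (sequences G k))
                            (cong (Q (proj₂ x) b *_) (sum-mass k (next x b))))

  tour⁺ : ∀ {k A a} (w : Vec (Fin n) k) → IsWalk G (a ∷ w) → last (a ∷ w) ≡ v → v Vec.∉ init (a ∷ w) →
    (∀ x → x ∈ A ⊎ x Vec.∈ (a ∷ w)) → Tour A (a ∷ w)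
  tour⁺ {A = A} {a} [] _ a≡v _ cov = stop (a≡v , λ x → x∈p∪q⁺ (⊎-map id (λ { (here refl) → x∈⁅x⁆ x }) (cov x)))
  tour⁺ {A = A} {a} (b ∷ w) (e ∷ l) last≡v v∉ cov = step (λ a≡v → v∉ (here (sym a≡v))) e
    (tour⁺ w l last≡v (v∉ ∘ there) λ x → [ inj₁ ∘ p⊆p∪q ⁅ a ⁆
      , (λ { (here refl) → inj₁ (q⊆p∪q A ⁅ a ⁆ (x∈⁅x⁆ a)) ; (there x∈) → inj₂ x∈ }) ]′ (cov x))

  tour⁻ : ∀ {k A a} {w : Vec (Fin n) k} → Tour A (a ∷ w) → IsWalk G (a ∷ w) × last (a ∷ w) ≡ v ×
    v Vec.∉ init (a ∷ w) × (∀ x → x ∈ A ⊎ x Vec.∈ (a ∷ w))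
  tour⁻ {A = A} {a} (stop (a≡v , cov)) = [-] , a≡v , (λ ()) ,
    λ x → ⊎-map id (here ∘ x∈⁅y⁆⇒x≡y a) (x∈p∪q⁻ A ⁅ a ⁆ (cov x))
  tour⁻ {A = A} {a} (step a≢v e t) with tour⁻ t
  ... | l , last≡v , v∉ , cov = e ∷ l , last≡v , (λ { (here v≡a) → a≢v (sym v≡a) ; (there v∈) → v∉ v∈ }) ,
    λ x → [ ⊎-map id (here ∘ x∈⁅y⁆⇒x≡y a) ∘ x∈p∪q⁻ A ⁅ a ⁆ , inj₂ ∘ there ]′ (cov x)

  L⇒tour : ∀ {k u a} {w : Vec (Fin n) k} → L G u v (a ∷ w) → a ≡ u × Tour ⊥ (a ∷ w)
  L⇒tour {w = w} ((l , cov , ¬cov) , a≡u , last≡v) = a≡u , tour⁺ w l last≡v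
    (λ v∈ → ¬cov λ x → [ id , (λ x≡last → subst (Vec._∈ _) (sym (trans x≡last last≡v)) v∈) ]′ (∈-init⊎last _ (cov x)))
    (inj₂ ∘ cov)

  tour⇒L : ∀ {k a} {w : Vec (Fin n) k} → Tour ⊥ (a ∷ w) → L G a v (a ∷ w)
  tour⇒L t with tour⁻ t
  ... | l , last≡v , v∉ , cov =
    (l , (λ x → [ (λ x∈⊥ → contradiction x∈⊥ ∉⊥) , id ]′ (cov x)) , (λ all → v∉ (all v))) , refl , last≡v

  ℙL-iterate : ∀ u k → ℙL[_,_]at G u v k ≡ iterate β k (⊥ , u)
  ℙL-iterate u k = begin
    ℙL[_,_]at G u v k
      ≡⟨ sumOver-filter (L? G u v) (weight G) (sequences G (suc k)) ⟩
    sumOver (sequences G (suc k)) restricted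
      ≡⟨ sumOver-product _∷_ restricted id (sequences G k) ⟩
    sum (λ a → sumOver (sequences G k) (restricted ∘ (a ∷_)))
      ≡⟨ sum-cong-≗ start ⟩
    sum (λ a → if does (a ≟ u) then iterate β k (⊥ , a) else 0ℚ)
      ≡⟨ sum-δ u (λ a → iterate β k (⊥ , a)) ⟩
    iterate β k (⊥ , u) ∎
    where
    open ≡-Reasoning
    restricted : Vec (Fin n) (suc k) → ℚ
    restricted w = if does (L? G u v w) then weight G w else 0ℚ

    restricted-L : ∀ {w} → L G u v w → restricted w ≡ weight G w
    restricted-L {w} p = cong (if_then weight G w else 0ℚ) (dec-true (L? G u v w) p)

    restricted-¬L : ∀ {w} → ¬ L G u v w → restricted w ≡ 0ℚ
    restricted-¬L {w} ¬p = cong (if_then weight G w else 0ℚ) (dec-false (L? G u v w) ¬p)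

    restricted-mass : ∀ w → restricted (u ∷ w) ≡ mass (⊥ , u) w
    restricted-mass w = case L? G u v (u ∷ w) of λ where
      (yes p) → trans (restricted-L p) (sym (mass-tour (proj₂ (L⇒tour p))))
      (no ¬p) → trans (restricted-¬L ¬p) (sym (mass-nonTour w (¬p ∘ tour⇒L)))

    start : ∀ a → sumOver (sequences G k) (restricted ∘ (a ∷_)) ≡ (if does (a ≟ u) then iterate β k (⊥ , a) else 0ℚ)
    start a = case a ≟ u of λ where
      (yes refl) → trans (sumOver-cong restricted-mass (sequences G k)) (trans (sum-mass k (⊥ , a))
        (sym (cong (if_then iterate β k (⊥ , a) else 0ℚ) (dec-true (a ≟ a) refl))))
      (no a≢u)   → trans (sumOver-cong (λ w → restricted-¬L {a ∷ w} (a≢u ∘ proj₁ ∘ L⇒tour)) (sequences G k))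
        (trans (sumOver-zero (sequences G k))
          (sym (cong (if_then iterate β k (⊥ , a) else 0ℚ) (dec-false (a ≟ u) a≢u))))

  T1≤1 : ∀ x → T (λ _ → 1ℚ) x ≤ 1ℚ
  T1≤1 (_ , a) = Killed-T1≤1 a

  abstract
    h : State → ℚ
    h = proj₁ (fixedPoint β 0≤β)

    0≤h : ∀ x → 0ℚ ≤ h x
    0≤h = proj₁ (proj₂ (fixedPoint β 0≤β))

    h-eq : ∀ x → h x ≡ β x + T h x
    h-eq = proj₂ (proj₂ (fixedPoint β 0≤β))

    lifetime : State → ℚ
    lifetime = proj₁ (fixedPoint (λ _ → 1ℚ) (λ _ → nonNegative⁻¹ 1ℚ))

    0≤lifetime : ∀ x → 0ℚ ≤ lifetime x
    0≤lifetime = proj₁ (proj₂ (fixedPoint (λ _ → 1ℚ) (λ _ → nonNegative⁻¹ 1ℚ)))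

    lifetime-eq : ∀ x → lifetime x ≡ 1ℚ + T lifetime x
    lifetime-eq = proj₂ (proj₂ (fixedPoint (λ _ → 1ℚ) (λ _ → nonNegative⁻¹ 1ℚ)))

  open Limit T1≤1 {β} {h} {lifetime} {proj₁ (bound h)} 0≤h h-eq
    (proj₂ (proj₂ (bound h))) (proj₁ (proj₂ (bound h))) 0≤lifetime lifetime-eq

  h-mono : ∀ {A B} a → A ⊆ B → h (A , a) ≤ h (B , a)
  h-mono a A⊆B = limit-mono λ k → iterate-mono k a A⊆B

  h-mono-< : ∀ {k u A B a} {w : Vec (Fin n) k} → Tour B (a ∷ w) → A ⊆ B → u ∉ A → u Vec.∉ (a ∷ w) →
    h (A , a) < h (B , a)
  h-mono-< {u = u} {A} {B} {a} (stop fin) A⊆B u∉A u∉w = begin-strict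
    h (A , a)                ≡⟨ h-eq (A , a) ⟩
    β (A , a) + T h (A , a)  <⟨ +-mono-<-≤ β< (sum-mono-≤ λ b → *-monoˡ-≤ (0≤Q a b) (h-mono b (∪-monoˡ {A} A⊆B))) ⟩
    β (B , a) + T h (B , a)  ≡⟨ h-eq (B , a) ⟨
    h (B , a)                ∎
    where
    open ≤-Reasoning
    β< : β (A , a) < β (B , a)
    β< rewrite β-final fin | β-nonFinal {A , a} (λ (_ , cov) →
      [ u∉A , u∉w ∘ here ∘ x∈⁅y⁆⇒x≡y a ]′ (x∈p∪q⁻ A ⁅ a ⁆ (cov u))) = positive⁻¹ 1ℚ
  h-mono-< {u = u} {A} {B} {a} (step {b = b} a≢v e t) A⊆B u∉A u∉w = begin-strict
    h (A , a)                ≡⟨ h-eq (A , a) ⟩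
    β (A , a) + T h (A , a)  <⟨ +-mono-≤-< (β-mono a A⊆B) (sum-mono-<
                                  (λ c → *-monoˡ-≤ (0≤Q a c) (h-mono c (∪-monoˡ {A} A⊆B))) b
                                  (*-monoʳ-< (0<Q a≢v e) (h-mono-< t (∪-monoˡ {A} A⊆B)
                                    ([ u∉A , u∉w ∘ here ∘ x∈⁅y⁆⇒x≡y a ]′ ∘ x∈p∪q⁻ A ⁅ a ⁆) (u∉w ∘ there)))) ⟩
    β (B , a) + T h (B , a)  ≡⟨ h-eq (B , a) ⟨
    h (B , a)                ∎
    where open ≤-Reasoning

  ℙL-mono-≤ : ∀ {x y} → h (⊥ , x) ≤ h (⊥ , y) → ℙL G x v ≤ᶜ ℙL G y v
  ℙL-mono-≤ {x} {y} hx≤hy (m , lt) =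
    let m′ , lt′ = neumann-approaches (⊥ , y) (<-≤-trans lt (≤-trans
          (≤-reflexive (partialSum-cong (ℙL-iterate x) m)) (≤-trans (neumann≤h m (⊥ , x)) hx≤hy)))
    in m′ , <-≤-trans lt′ (≤-reflexive (sym (partialSum-cong (ℙL-iterate y) m′)))

  ℙL-mono-< : ∀ {x y} → h (⊥ , x) < h (⊥ , y) → ℙL G x v <ᶜ ℙL G y v
  ℙL-mono-< {x} {y} hx<hy = h (⊥ , x) ,
    (λ (m , lt) → <-irrefl refl (<-≤-trans lt (≤-trans
      (≤-reflexive (partialSum-cong (ℙL-iterate x) m)) (neumann≤h m (⊥ , x))))) ,
    (let m , lt = neumann-approaches (⊥ , y) hx<hy
     in m , <-≤-trans lt (≤-reflexive (sym (partialSum-cong (ℙL-iterate y) m))))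

  module _ {u : Fin n} (v≢u : v ≢ u) where

    outNeighbour : ∃[ b ] u ⟶ b
    outNeighbour with connected u v
    ... | ε      = contradiction refl v≢u
    ... | e ◅ _  = _ , e

    best : Fin n
    best = argmin (λ x → h (⊥ , x)) (proj₁ outNeighbour) (List.filter (u ⟶?_) (List.allFin n))

    u⟶best : u ⟶ best
    u⟶best = argmin-all (λ x → h (⊥ , x)) (proj₂ outNeighbour) (all-filter (u ⟶?_) (List.allFin n))

    best-minimal : ∀ {y} → u ⟶ y → h (⊥ , best) ≤ h (⊥ , y)
    best-minimal {y} e = All.lookup (f[argmin]≤f[xs] {f = λ x → h (⊥ , x)} (proj₁ outNeighbour) _)
      (∈-filter⁺ (u ⟶?_) (∈-allFin y) e)

    average : ℚ
    average = sum (λ y → Q u y * h (⊥ , y))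

    best≤average : h (⊥ , best) ≤ average
    best≤average = begin
      c                          ≡⟨ *-identityʳ c ⟨
      c * 1ℚ                     ≡⟨ cong (c *_) (sum-Q≡1 (v≢u ∘ sym) u⟶best) ⟨
      c * sum (Q u)              ≡⟨ *-distribˡ-sum c (Q u) ⟩
      sum (λ y → c * Q u y)      ≤⟨ sum-mono-≤ termwise ⟩
      average                    ∎
      where
      open ≤-Reasoning
      c = h (⊥ , best)
      termwise : ∀ y → c * Q u y ≤ Q u y * h (⊥ , y)
      termwise y = case u ⟶? y of λ where
        (yes e) → subst (_≤ Q u y * h (⊥ , y)) (*-comm (Q u y) c) (*-monoˡ-≤ (0≤Q u y) (best-minimal e))
        (no ¬e) → ≤-reflexive (trans (cong (c *_) (Q-nonEdge ¬e)) (trans (*-zeroʳ c)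
          (sym (trans (cong (_* h (⊥ , y)) (Q-nonEdge ¬e)) (*-zeroˡ (h (⊥ , y)))))))

    T≤h : T h (⊥ , u) ≤ h (⊥ , u)
    T≤h = subst (T h (⊥ , u) ≤_) (sym (h-eq (⊥ , u))) (p≤q+p (0≤β (⊥ , u)))

    average≤T-termwise : ∀ y → Q u y * h (⊥ , y) ≤ Q u y * h (⊥ ∪ ⁅ u ⁆ , y)
    average≤T-termwise y = *-monoˡ-≤ (0≤Q u y) (h-mono y ⊥⊆)

    best≤u : h (⊥ , best) ≤ h (⊥ , u)
    best≤u = ≤-trans best≤average (≤-trans (sum-mono-≤ average≤T-termwise) T≤h)

    best<u : HasCoveringWalkNotRevisitingStart G u v → h (⊥ , best) < h (⊥ , u)
    best<u (_ , a ∷ [] , _ , refl , last≡v , _) = contradiction (sym last≡v) v≢u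
    best<u (_ , a ∷ b ∷ w , walk , refl , last≡v , v∉ , cov , u∉)
      with tour⁺ {A = ⊥} (b ∷ w) walk last≡v v∉ (inj₂ ∘ cov)
    ... | step a≢v e t = ≤-<-trans best≤average (<-≤-trans
      (sum-mono-< average≤T-termwise b (*-monoʳ-< (0<Q a≢v e) (h-mono-< t ⊥⊆ ∉⊥ u∉))) T≤h)

lemma1 : ∀ {n : ℕ} (G : Digraph n) → let open Digraph G in
    Connected G →
    ∀ (u v : Fin n) → v ≢ u → ¬ (u ⟶ v) →
    (∃[ x ] (u ⟶ x × ℙL G x v ≤ᶜ ℙL G u v)) ×
    (HasCoveringWalkNotRevisitingStart G u v →
    ∃[ x ] (u ⟶ x × ℙL G x v <ᶜ ℙL G u v))
lemma1 G connected u v v≢u _ =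
  (best G connected v v≢u , u⟶best G connected v v≢u , ℙL-mono-≤ G connected v (best≤u G connected v v≢u)) ,
  λ walk → best G connected v v≢u , u⟶best G connected v v≢u ,
    ℙL-mono-< G connected v (best<u G connected v v≢u walk)
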